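{- Let $H$ be Hall's universal group. For every positive integer $m$ we have $T(D_{2m}, H) = \infty$. Consequently, $H$ does not have finite big Ramsey degrees.
   Context: Hall's universal group $H$ is the Fraïssé limit of the class of all finite groups: the (unique up to isomorphism) countable locally finite group that embeds every finite group and in which every isomorphism between two finite subgroups extends to an automorphism of $H$. For a positive integer $n$, $D_n$ denotes the dihedral group with $2n$ elements, $D_n = \langle a, b \mid a^2 = 1, b^2 = 1, (ab)^n = (ba)^n = 1\rangle$; so $D_{2m}$ has $4m$ elements, and $D_2 \cong C_2 \times C_2$. For first-order structures $A, B$ of the same signature, $\mathrm{Emb}(A,B)$ denotes the set of all embeddings $A \hookrightarrow B$ (for groups: injective homomorphisms). Let $A$ be a finite structure and $S$ a locally finite structure. The big Ramsey degree $T(A,S)$ of $A$ in $S$ is the least positive integer $n$, if it exists, such that for every positive integer $k$ and every coloring $\chi : \mathrm{Emb}(A,S) \to \{0,\dots,k-1\}$ there is $w \in \mathrm{Emb}(S,S)$ with $|\chi(w \circ \mathrm{Emb}(A,S))| \le n$, where $w \circ \mathrm{Emb}(A,S) = \{w \circ f : f \in \mathrm{Emb}(A,S)\}$. If no such $n$ exists, write $T(A,S) = \infty$. The structure $S$ has finite big Ramsey degrees if $T(A,S) < \infty$ for every finitely generated substructure $A$ of $S$. -}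

module Defs where

open import Algebra.Bundles using (Group)
open import Algebra.Morphism.Structures
  using (IsGroupMonomorphism; IsGroupIsomorphism)
import Algebra.Morphism.Construct.Composition as Comp
open import Data.Fin.Base using (Fin)
open import Data.Fin.Subset using (Subset; _∈_; ∣_∣)
open import Data.List.Base using (List)
import Data.List.Membership.Setoid as ListMembership
open import Data.Nat.Base using (ℕ; zero; suc; _≤_; _<_)
open import Data.Product.Base using (Σ; ∃; _×_; _,_)
open import Function.Base using (_∘_)
open import Function.Bundles using (Func; Bijection)
open import Level using (0ℓ)
open import Relation.Binary.Bundles using (Setoid)
open import Relation.Binary.PropositionalEquality using (_≡_)
import Relation.Binary.PropositionalEquality as ≡
open import Relation.Nullary using (¬_)
open import Relation.Unary using (Pred)

-- Everything below concerns countable groups, so the lowest universe suffices.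
Grp : Set₁
Grp = Group 0ℓ 0ℓ

record Embedding (A B : Grp) : Set where
  private
    module A = Group A
    module B = Group B
  field
    to                  : A.Carrier → B.Carrier
    isGroupMonomorphism : IsGroupMonomorphism A.rawGroup B.rawGroup to

  open IsGroupMonomorphism isGroupMonomorphism public

-- Two embeddings are the same when they agree pointwise up to the equality
-- of the codomain.
Emb : Grp → Grp → Setoid 0ℓ 0ℓ
Emb A B = record
  { Carrier       = Embedding A B
  ; _≈_           = λ f g → ∀ x → Embedding.to f x ≈ Embedding.to g x
  ; isEquivalence = record
    { refl  = λ _ → refl
    ; sym   = λ p x → sym (p x)
    ; trans = λ p q x → trans (p x) (q x)
    }
  }
  where open Group B

infixr 9 _∘ₑ_

_∘ₑ_ : {A B C : Grp} → Embedding B C → Embedding A B → Embedding A C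
_∘ₑ_ {C = C} g f = record
  { to                  = g.to ∘ f.to
  ; isGroupMonomorphism =
      Comp.isGroupMonomorphism (Group.trans C)
        f.isGroupMonomorphism g.isGroupMonomorphism
  }
  where
  module f = Embedding f
  module g = Embedding g

record Isomorphism (A B : Grp) : Set where
  private
    module A = Group A
    module B = Group B
  field
    to                 : A.Carrier → B.Carrier
    isGroupIsomorphism : IsGroupIsomorphism A.rawGroup B.rawGroup to

-- A subgroup is given by its own group structure and its inclusion map.
record Subgroup (G : Grp) : Set₁ where
  field
    group     : Grp
    inclusion : Embedding group G

Finite : Grp → Set
Finite G = ∃ λ n → Bijection (Group.setoid G) (≡.setoid (Fin n))

Denumerable : Grp → Set
Denumerable G = Bijection (≡.setoid ℕ) (Group.setoid G)

module _ (G : Grp) where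
  open Group G
  open ListMembership setoid using () renaming (_∈_ to _∈ₗ_)

  data Generated (gs : List Carrier) : Pred Carrier 0ℓ where
    gen  : ∀ {x} → x ∈ₗ gs → Generated gs x
    unit : Generated gs ε
    mul  : ∀ {x y} → Generated gs x → Generated gs y → Generated gs (x ∙ y)
    inv  : ∀ {x} → Generated gs x → Generated gs (x ⁻¹)
    resp : ∀ {x y} → x ≈ y → Generated gs x → Generated gs y

  FinitelyGenerated : Set
  FinitelyGenerated = ∃ λ gs → ∀ x → Generated gs x

LocallyFinite : Grp → Set₁
LocallyFinite G =
  ∀ (A : Subgroup G) → let open Subgroup A in
  FinitelyGenerated group → Finite group

EmbedsFiniteGroups : Grp → Set₁
EmbedsFiniteGroups G = ∀ (F : Grp) → Finite F → Embedding F G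

Ultrahomogeneous : Grp → Set₁
Ultrahomogeneous G =
  ∀ (A B : Subgroup G) →
  let module A = Subgroup A
      module B = Subgroup B
  in
  Finite A.group → Finite B.group → (φ : Isomorphism A.group B.group) →
  ∃ λ (σ : Isomorphism G G) → ∀ x →
    Isomorphism.to σ (Embedding.to A.inclusion x)
      ≈ Embedding.to B.inclusion (Isomorphism.to φ x)
  where open Group G using (_≈_)

-- A group embedding every finite group is infinite, so for it being countable
-- means being in bijection with ℕ.
record IsHallUniversalGroup (H : Grp) : Set₁ where
  field
    countable          : Denumerable H
    locallyFinite      : LocallyFinite H
    embedsFiniteGroups : EmbedsFiniteGroups H
    ultrahomogeneous   : Ultrahomogeneous H

infix  8 _⁻¹ₜ
infixl 7 _·_
infixr 8 _^_

data Term (X : Set) : Set where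
  var  : X → Term X
  εₜ   : Term X
  _·_  : Term X → Term X → Term X
  _⁻¹ₜ : Term X → Term X

_^_ : {X : Set} → Term X → ℕ → Term X
t ^ zero  = εₜ
t ^ suc n = t · t ^ n

-- The least congruence on terms that satisfies the group axioms and makes
-- every relator trivial.
module Presentation {X : Set} (Relator : Pred (Term X) 0ℓ) where

  infix 4 _~_

  data _~_ : Term X → Term X → Set where
    ~-refl   : ∀ {s} → s ~ s
    ~-sym    : ∀ {s t} → s ~ t → t ~ s
    ~-trans  : ∀ {s t u} → s ~ t → t ~ u → s ~ u
    ·-cong   : ∀ {s s′ t t′} → s ~ s′ → t ~ t′ → s · t ~ s′ · t′
    ⁻¹-cong  : ∀ {s t} → s ~ t → s ⁻¹ₜ ~ t ⁻¹ₜ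
    assoc    : ∀ s t u → (s · t) · u ~ s · (t · u)
    idˡ      : ∀ s → εₜ · s ~ s
    idʳ      : ∀ s → s · εₜ ~ s
    invˡ     : ∀ s → s ⁻¹ₜ · s ~ εₜ
    invʳ     : ∀ s → s · s ⁻¹ₜ ~ εₜ
    relator  : ∀ {r} → Relator r → r ~ εₜ

  presentedGroup : Grp
  presentedGroup = record
    { Carrier = Term X
    ; _≈_     = _~_
    ; _∙_     = _·_
    ; ε       = εₜ
    ; _⁻¹     = _⁻¹ₜ
    ; isGroup = record
      { isMonoid = record
        { isSemigroup = record
          { isMagma = record
            { isEquivalence = record
              { refl = ~-refl ; sym = ~-sym ; trans = ~-trans }
            ; ∙-cong = ·-cong
            }
          ; assoc = assoc
          }
        ; identity = idˡ , idʳ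
        }
      ; inverse = invˡ , invʳ
      ; ⁻¹-cong = ⁻¹-cong
      }
    }

data DihedralGen : Set where
  a b : DihedralGen

data DihedralRelator (n : ℕ) : Pred (Term DihedralGen) 0ℓ where
  a²     : DihedralRelator n (var a ^ 2)
  b²     : DihedralRelator n (var b ^ 2)
  [ab]^n : DihedralRelator n ((var a · var b) ^ n)
  [ba]^n : DihedralRelator n ((var b · var a) ^ n)

-- For n ≥ 1 this has 2n elements.
D : ℕ → Grp
D n = Presentation.presentedGroup (DihedralRelator n)

Coloring : Grp → Grp → ℕ → Set
Coloring A S k = Func (Emb A S) (≡.setoid (Fin k))

-- The set of colors χ(w ∘ Emb(A,S)).
ColorsOn : ∀ {A S k} → Coloring A S k → Embedding S S → Pred (Fin k) 0ℓ
ColorsOn χ w c = ∃ λ f → Func.to χ (w ∘ₑ f) ≡ c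

-- |P| ≤ n.  Subset k consists of the decidable subsets of Fin k, whereas P
-- need not be decidable; hence P is only required to lie inside one.
Card≤ : ∀ {k} → Pred (Fin k) 0ℓ → ℕ → Set
Card≤ {k} P n = Σ (Subset k) λ p → (∀ {c} → P c → c ∈ p) × ∣ p ∣ ≤ n

RamseyBound : Grp → Grp → ℕ → Set
RamseyBound A S n =
  ∀ k → 0 < k → (χ : Coloring A S k) →
  ∃ λ (w : Embedding S S) → Card≤ (ColorsOn {A} {S} χ w) n

IsBigRamseyDegree : Grp → Grp → ℕ → Set
IsBigRamseyDegree A S n =
  0 < n × RamseyBound A S n × (∀ n′ → 0 < n′ → RamseyBound A S n′ → n ≤ n′)

T[_,_]<∞ : Grp → Grp → Set
T[ A , S ]<∞ = ∃ λ n → IsBigRamseyDegree A S n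

T[_,_]≡∞ : Grp → Grp → Set
T[ A , S ]≡∞ = ¬ T[ A , S ]<∞

HasFiniteBigRamseyDegrees : Grp → Set₁
HasFiniteBigRamseyDegrees S =
  ∀ (A : Subgroup S) → let open Subgroup A in
  FinitelyGenerated group → T[ group , S ]<∞

{-# OPTIONS --safe #-}
module Submission where

-- Enumerate H as h₀, h₁, ….  For an element x let q(x, i) be one less than the
-- order of x hᵢ; it is finite because H is locally finite.  These numbers behave
-- like the labels of a random graph with infinitely many edge labels, and such
-- a graph has no finite big Ramsey degree for edges.  The colouring that
-- shows it reads the number q(x, i) as a list c ∷ is of natural numbers: position
-- i then assigns the colour c to the indices in is, but only to the first
-- `capacity i` of them.  An embedding f of the dihedral group is coloured by the
-- pair x = f a, y = f b: if y = h_N, its colour is the one assigned to N by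
-- the first position i < N that assigns a colour to N (`color`, `coloring`).
--
-- The capacities grow so fast that the positions before n₀ together assign
-- colours to fewer indices than position n₀ may, even when the indices up to n₀ are
-- counted among them.  Hence, if q(x, n₀) encodes the colour c and a list of
-- `capacity n₀` distinct indices, then pigeonhole gives one of these indices that is
-- larger than n₀ and gets no colour from an earlier position, so it gets the colour c
-- (`color-attained`), whatever the numbers q(x, i) for i other than n₀ are.
--
-- Now let w be a self-embedding of H, and c a colour.  Fix an involution v
-- of H and let w v = h_{n₀}.  Ultrahomogeneity, in the form of the
-- extension property `extend`, gives `capacity n₀` involutions yₛ in H together
-- with v: they come from the finite group D₂ₘ × D_M × C₂, M = capacity n₀, in which
-- v = (α, 1, t) and yₛ = (β, s-th reflection, 1), where α and β are the generators
-- of D₂ₘ and t is that of C₂.  Only now, when the indices of the w yₛ are known,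
-- is q chosen as the code of c and of these indices.  Extending C₂ to a dihedral
-- group of order 2(1 + q), the generator t becomes a reflection, and one takes
-- x = (α, 1, u) for a reflection u such that u t has order 1 + q.  Then x v
-- has order 1 + q, and x and yₛ generate a copy of D₂ₘ for each s, since x yₛ has
-- order lcm(2m, 2) = 2m; here it matters that 2m is even (`Configuration`).  As w
-- preserves orders, one of these copies gets the colour c under w.  So every w meets
-- all the colours, however many there are.
--
-- The group D₂ is finite, so it embeds in H, and its image is a finitely generated
-- subgroup with infinite big Ramsey degree.

open import Defs
open import Algebra.Bundles using (CommutativeRing; Group)
import Algebra.Construct.DirectProduct as Direct
import Algebra.Definitions.RawMonoid as RawPower
import Algebra.Morphism.Construct.Identity as Identity
open import Algebra.Morphism.Structures using (IsGroupHomomorphism; IsGroupIsomorphism)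
import Algebra.Properties.Group as GroupProperties
import Algebra.Properties.Monoid.Mult as Power
open import Data.Bool.Base using (Bool; true; false; _xor_; if_then_else_)
import Data.Bool.Properties as Bool
open import Data.Fin.Base as Fin using (Fin; toℕ)
import Data.Fin.Properties as Fin
open import Data.Fin.Subset using (∣_∣; ⊤)
open import Data.Fin.Subset.Properties using (∣⊤∣≡n; p⊆q⇒∣p∣≤∣q∣)
open import Data.List.Base
  using (List; []; _∷_; _++_; length; take; drop; tabulate; upTo; lookup)
open import Data.List.Membership.DecPropositional using (_∈?_)
open import Data.List.Membership.Propositional using (_∈_; _∉_)
open import Data.List.Membership.Propositional.Properties
  using (∈-++⁺ˡ; ∈-++⁺ʳ; ∈-upTo⁺; ∈-tabulate⁺)
open import Data.List.Properties
  using (length-++; length-take; length-tabulate; length-upTo; take-all)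
open import Data.List.Relation.Unary.Any using (here; there; index)
open import Data.List.Relation.Unary.Any.Properties using (lookup-index)
open import Data.Maybe.Base using (Maybe; just; nothing; fromMaybe; _<∣>_)
open import Data.Nat.Base
  using (ℕ; zero; suc; _+_; _*_; _∸_; _≤_; _<_; z≤n; s≤s; s≤s⁻¹; _≤′_; ≤′-refl; ≤′-step)
open import Data.Nat.Binary.Base using (ℕᵇ; 2[1+_]; 1+[2_])
import Data.Nat.Binary.Base as ℕᵇ
open import Data.Nat.Binary.Properties using (fromℕ-toℕ)
open import Data.Nat.Divisibility using (∣⇒≤; m%n≡0⇒n∣m)
open import Data.Nat.DivMod
  using (_%_; _/_; _mod_; %-distribˡ-+; %-distribˡ-*; [m+kn]%n≡m%n; m*n%n≡0; m%n<n;
         m<n⇒m%n≡m; m≡m%n+[m/n]*n)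
import Data.Nat.Properties as ℕ
open import Data.Nat.Tactic.RingSolver using (solve-∀)
open import Data.Product.Base using (Σ; ∃; _×_; _,_; proj₁; proj₂)
open import Data.Product.Relation.Binary.Pointwise.NonDependent using (_×ₛ_)
open import Data.Sum.Base using (_⊎_; inj₁; inj₂)
open import Function.Base using (_∘_; id)
open import Function.Bundles using (Bijection; Func)
import Function.Construct.Symmetry as Symmetry
open import Function.Definitions using (Injective)
open import Function.Properties.Inverse using (Inverse⇒Bijection)
open import Level using (0ℓ)
open import Relation.Binary.Bundles using (Setoid)
open import Relation.Binary.Definitions using (Decidable)
open import Relation.Binary.PropositionalEquality as ≡ using (_≡_; _≗_; refl; cong; subst)
import Relation.Binary.Reasoning.Setoid as ≈-Reasoning
open import Relation.Nullary using (¬_; yes; no; contradiction)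
open import Relation.Nullary.Decidable using (map′)
open import Relation.Unary as Unary using (Pred)

-- Lists of natural numbers encoded as natural numbers

-- A bijective binary numeral is a word in the two digits 2[1+_] and 1+[2_].
-- The word is read as a list in unary: each 1+[2_] ends an entry, whose value is the
-- number of digits 2[1+_] before it.  The first argument counts those already read.
decodeFrom : ℕ → ℕᵇ → List ℕ
decodeFrom i ℕᵇ.zero = []
decodeFrom i 2[1+ x ] = decodeFrom (suc i) x
decodeFrom i 1+[2 x ] = i ∷ decodeFrom 0 x

decode : ℕ → List ℕ
decode q = decodeFrom 0 (ℕᵇ.fromℕ q)

doubling : ℕ → ℕᵇ → ℕᵇ
doubling zero    x = x
doubling (suc i) x = 2[1+ doubling i x ]

encodeᵇ : List ℕ → ℕᵇ
encodeᵇ []       = ℕᵇ.zero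
encodeᵇ (i ∷ is) = doubling i 1+[2 encodeᵇ is ]

encode : List ℕ → ℕ
encode = ℕᵇ.toℕ ∘ encodeᵇ

decodeFrom-doubling : ∀ j i x → decodeFrom j (doubling i x) ≡ decodeFrom (i + j) x
decodeFrom-doubling j zero    x = refl
decodeFrom-doubling j (suc i) x =
  ≡.trans (decodeFrom-doubling (suc j) i x) (cong (λ k → decodeFrom k x) (ℕ.+-suc i j))

decodeFrom-encodeᵇ : ∀ is → decodeFrom 0 (encodeᵇ is) ≡ is
decodeFrom-encodeᵇ []       = refl
decodeFrom-encodeᵇ (i ∷ is) = ≡.trans (decodeFrom-doubling 0 i _)
  (≡.cong₂ _∷_ (ℕ.+-identityʳ i) (decodeFrom-encodeᵇ is))

decode-encode : ∀ is → decode (encode is) ≡ is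
decode-encode is =
  ≡.trans (cong (decodeFrom 0) (fromℕ-toℕ (encodeᵇ is))) (decodeFrom-encodeᵇ is)

-- Colours assigned to indices by a sequence of numbers

-- capacity n: how many indices position n may assign a colour to.  room n: how many the
-- positions below n may assign a colour to together.  The capacity of n exceeds
-- room n by 2 + n, to leave room also for the 1 + n indices up to n.
room : ℕ → ℕ

capacity : ℕ → ℕ
capacity n = suc (suc n + room n)

room zero    = 0
room (suc n) = suc (suc n + room n) + room n

-- The indices to which position n assigns a colour.  Here and below x is the sequence
-- of codes; the head of a decoded list is the colour.
claims : (ℕ → ℕ) → ℕ → List ℕ
claims x n = take (capacity n) (drop 1 (decode (x n)))

-- The colour, if any, that position n assigns to N, given its decoded list.
vote : ℕ → ℕ → List ℕ → Maybe ℕ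
vote n N []       = nothing
vote n N (c ∷ is) with _∈?_ ℕ._≟_ N (take (capacity n) is)
... | yes _ = just c
... | no  _ = nothing

-- The colour assigned to N by the first position below n that assigns one.
firstVote : (ℕ → ℕ) → ℕ → ℕ → Maybe ℕ
firstVote x N zero    = nothing
firstVote x N (suc n) = firstVote x N n <∣> vote n N (decode (x n))

-- The colour of N under x.  It defaults to 0 when no position below N assigns one.
color : (ℕ → ℕ) → ℕ → ℕ
color x N = fromMaybe 0 (firstVote x N N)

firstVote-cong : ∀ {x y} → x ≗ y → ∀ N n → firstVote x N n ≡ firstVote y N n
firstVote-cong x≗y N zero    = refl
firstVote-cong x≗y N (suc n) =
  ≡.cong₂ _<∣>_ (firstVote-cong x≗y N n) (cong (vote n N ∘ decode) (x≗y n))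

color-cong : ∀ {x y} → x ≗ y → ∀ N → color x N ≡ color y N
color-cong x≗y N = cong (fromMaybe 0) (firstVote-cong x≗y N N)

-- The indices to which some position below n assigns a colour, with repetitions.
allClaims : (ℕ → ℕ) → ℕ → List ℕ
allClaims x zero    = []
allClaims x (suc n) = claims x n ++ allClaims x n

length-allClaims : ∀ x n → length (allClaims x n) ≤ room n
length-allClaims x zero    = z≤n
length-allClaims x (suc n) = begin
  length (claims x n ++ allClaims x n)         ≡⟨ length-++ (claims x n) ⟩
  length (claims x n) + length (allClaims x n)
    ≤⟨ ℕ.+-mono-≤ length-claims (length-allClaims x n) ⟩
  capacity n + room n                          ∎
  where
  open ℕ.≤-Reasoning
  xs = drop 1 (decode (x n))
  length-claims : length (claims x n) ≤ capacity n
  length-claims =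
    subst (_≤ capacity n) (≡.sym (length-take (capacity n) xs)) (ℕ.m⊓n≤m _ (length xs))

vote-unclaimed : ∀ n N is → N ∉ take (capacity n) (drop 1 is) → vote n N is ≡ nothing
vote-unclaimed n N []       N∉ = refl
vote-unclaimed n N (c ∷ is) N∉ with _∈?_ ℕ._≟_ N (take (capacity n) is)
... | yes N∈ = contradiction N∈ N∉
... | no  _  = refl

vote-claimed : ∀ n N c is → N ∈ take (capacity n) is → vote n N (c ∷ is) ≡ just c
vote-claimed n N c is N∈ with _∈?_ ℕ._≟_ N (take (capacity n) is)
... | yes _  = refl
... | no  N∉ = contradiction N∈ N∉

firstVote-unclaimed : ∀ x N n → N ∉ allClaims x n → firstVote x N n ≡ nothing
firstVote-unclaimed x N zero    N∉ = refl
firstVote-unclaimed x N (suc n) N∉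
  rewrite firstVote-unclaimed x N n (N∉ ∘ ∈-++⁺ʳ (claims x n))
  = vote-unclaimed n N (decode (x n)) (N∉ ∘ ∈-++⁺ˡ)

firstVote-stable : ∀ {x N m n c} → m ≤′ n → firstVote x N m ≡ just c → firstVote x N n ≡ just c
firstVote-stable ≤′-refl        eq = eq
firstVote-stable (≤′-step m≤′n) eq rewrite firstVote-stable m≤′n eq = refl

-- Pigeonhole: a list shorter than the range of an injective sequence misses a value.
injective⇒∉ : ∀ {M} (f : Fin M → ℕ) → Injective _≡_ _≡_ f →
  ∀ is → length is < M → ∃ λ s → f s ∉ is
injective⇒∉ {M} f f-inj is ∣is∣<M =
  Fin.¬∀⟶∃¬ M (λ s → f s ∈ is) (λ s → _∈?_ ℕ._≟_ (f s) is) λ f∈is →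
  ℕ.<⇒≱ ∣is∣<M (Fin.injective⇒≤ {f = index ∘ f∈is} λ {s} {t} eq → f-inj (begin
    f s                          ≡⟨ lookup-index (f∈is s) ⟩
    lookup is (index (f∈is s))   ≡⟨ cong (lookup is) eq ⟩
    lookup is (index (f∈is t))   ≡⟨ lookup-index (f∈is t) ⟨
    f t                          ∎))
  where open ≡.≡-Reasoning

-- The obstacles to giving f s the colour c are the indices up to n, which do not look at
-- position n, and those claimed by positions before n.  They are too few.
color-attained : ∀ x n c (f : Fin (capacity n) → ℕ) → Injective _≡_ _≡_ f →
  decode (x n) ≡ c ∷ tabulate f → ∃ λ s → color x (f s) ≡ c
color-attained x n c f f-inj decode≡ =
  s , cong (fromMaybe 0) (firstVote-stable (ℕ.≤⇒≤′ n<N) first)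
  where
  obstacles : List ℕ
  obstacles = upTo (suc n) ++ allClaims x n

  few : length obstacles < capacity n
  few = s≤s (subst (_≤ suc n + room n) (≡.sym (length-++ (upTo (suc n))))
    (ℕ.+-mono-≤ (ℕ.≤-reflexive (length-upTo (suc n))) (length-allClaims x n)))

  free : ∃ λ s → f s ∉ obstacles
  free = injective⇒∉ f f-inj obstacles few
  s = proj₁ free
  N = f s

  n<N : n < N
  n<N = ℕ.≮⇒≥ λ N<1+n → proj₂ free (∈-++⁺ˡ (∈-upTo⁺ N<1+n))

  claimed : N ∈ take (capacity n) (tabulate f)
  claimed = subst (N ∈_) (≡.sym (take-all _ _ (ℕ.≤-reflexive (length-tabulate f))))
    (∈-tabulate⁺ {f = f} s)

  first : firstVote x N (suc n) ≡ just c
  first rewrite firstVote-unclaimed x N n (proj₂ free ∘ ∈-++⁺ʳ (upTo (suc n))) | decode≡ =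
    vote-claimed n N c _ claimed

-- Homomorphisms and direct products

infixr 8 _⊗_
_⊗_ : Grp → Grp → Grp
_⊗_ = Direct.group

-- The k-th power of x, by the iterated operation of the underlying monoid.
pow : (G : Grp) → ℕ → Group.Carrier G → Group.Carrier G
pow G = RawPower._×_ (Group.rawMonoid G)

record Homomorphism (A B : Grp) : Set where
  private
    module A = Group A
    module B = Group B
  field
    to                  : A.Carrier → B.Carrier
    isGroupHomomorphism : IsGroupHomomorphism A.rawGroup B.rawGroup to
  open IsGroupHomomorphism isGroupHomomorphism public

-- A map of groups that preserves products preserves the unit and inverses.
mkHomomorphism : ∀ {A B : Grp} (let module A = Group A; module B = Group B)
  (f : A.Carrier → B.Carrier) → (∀ {x y} → x A.≈ y → f x B.≈ f y) →
  (∀ x y → f (x A.∙ y) B.≈ f x B.∙ f y) → Homomorphism A B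
mkHomomorphism {A} {B} f f-cong f-∙ = record
  { to = f
  ; isGroupHomomorphism = record
    { isMonoidHomomorphism = record
      { isMagmaHomomorphism = record
        { isRelHomomorphism = record { cong = f-cong }
        ; homo              = f-∙
        }
      ; ε-homo = f-ε
      }
    ; ⁻¹-homo = λ x → inverseˡ-unique (f (x A.⁻¹)) (f x)
        (B.trans (B.sym (f-∙ _ _)) (B.trans (f-cong (A.inverseˡ x)) f-ε))
    }
  }
  where
  module A = Group A
  module B = Group B
  open GroupProperties B using (inverseˡ-unique; identityˡ-unique)
  f-ε : f A.ε B.≈ B.ε
  f-ε = identityˡ-unique (f A.ε) (f A.ε) (B.trans (B.sym (f-∙ _ _)) (f-cong (A.identityˡ A.ε)))

mkEmbedding : ∀ {A B : Grp} (φ : Homomorphism A B) (let module A = Group A; module B = Group B) →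
  (∀ {x y} → Homomorphism.to φ x B.≈ Homomorphism.to φ y → x A.≈ y) → Embedding A B
mkEmbedding φ inj = record
  { to = Homomorphism.to φ
  ; isGroupMonomorphism = record
    { isGroupHomomorphism = Homomorphism.isGroupHomomorphism φ ; injective = inj } }

⟨_,_⟩ : ∀ {A B C} → Embedding A B → Homomorphism A C → Embedding A (B ⊗ C)
⟨_,_⟩ {A} {B} {C} e φ = mkEmbedding
  (mkHomomorphism {A} {B ⊗ C} (λ x → e.to x , φ.to x)
    (λ x≈y → e.⟦⟧-cong x≈y , φ.⟦⟧-cong x≈y) (λ x y → e.∙-homo x y , φ.homo x y))
  (e.injective ∘ proj₁)
  where
  module e = Embedding e
  module φ = Homomorphism φ

pair : ∀ {A B C} → Homomorphism A B → Homomorphism A C → Homomorphism A (B ⊗ C)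
pair {A} {B} {C} φ ψ = mkHomomorphism {A} {B ⊗ C} (λ x → φ.to x , ψ.to x)
    (λ x≈y → φ.⟦⟧-cong x≈y , ψ.⟦⟧-cong x≈y) (λ x y → φ.homo x y , ψ.homo x y)
  where
  module φ = Homomorphism φ
  module ψ = Homomorphism ψ

infixr 8 id⊗_
id⊗_ : ∀ {A B C} → Embedding B C → Embedding (A ⊗ B) (A ⊗ C)
id⊗_ {A} {B} {C} e = mkEmbedding
  (mkHomomorphism {A ⊗ B} {A ⊗ C} (λ (x , y) → x , e.to y)
    (λ (p , q) → p , e.⟦⟧-cong q) (λ (x , y) (x′ , y′) → Group.refl A , e.∙-homo y y′))
  λ (p , q) → p , e.injective q
  where
  module e = Embedding e

-- Powers and orders

module _ {A B : Grp} (e : Embedding A B) where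
  private
    module B = Group B
    module e = Embedding e

  pow-homo : ∀ n x → e.to (pow A n x) B.≈ pow B n (e.to x)
  pow-homo zero    x = e.ε-homo
  pow-homo (suc n) x = B.trans (e.∙-homo x _) (B.∙-congˡ (pow-homo n x))

module _ (G : Grp) where
  open Group G

  -- The unit counts as involutive.
  Involutive : Carrier → Set
  Involutive x = x ∙ x ≈ ε

  -- k is a period of x, not necessarily the least one.
  Period : ℕ → Carrier → Set
  Period k x = pow G k x ≈ ε

  pow-ε : ∀ n → pow G n ε ≈ ε
  pow-ε zero    = Group.refl G
  pow-ε (suc n) = trans (identityˡ _) (pow-ε n)

  pow-involution : ∀ {x} → Involutive x → ∀ m → Period (2 * m) x
  pow-involution {x} x²≈ε m = begin
    pow G (2 * m) x       ≈⟨ ×-congˡ (ℕ.*-comm 2 m) ⟩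
    pow G (m * 2) x       ≈⟨ ×-assocˡ x m 2 ⟨
    pow G m (pow G 2 x)   ≈⟨ ×-congʳ m (trans (∙-congˡ (identityʳ x)) x²≈ε) ⟩
    pow G m ε             ≈⟨ pow-ε m ⟩
    ε                     ∎
    where
    open Power monoid
    open ≈-Reasoning setoid

  -- x has order 1 + d.  The shift by one makes every natural number d possible.
  HasOrder1+ : Carrier → ℕ → Set
  HasOrder1+ x d = Period (suc d) x × (∀ e → Period (suc e) x → d ≤ e)

  order-cong : ∀ {x y d} → x ≈ y → HasOrder1+ x d → HasOrder1+ y d
  order-cong {d = d} x≈y (p , d≤) =
      trans (Power.×-congʳ monoid (suc d) (sym x≈y)) p
    , λ e q → d≤ e (trans (Power.×-congʳ monoid (suc e) x≈y) q)

  order-unique : ∀ {x y d e} → x ≈ y → HasOrder1+ x d → HasOrder1+ y e → d ≡ e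
  order-unique {d = d} {e} x≈y (p , d≤) (q , e≤) = ℕ.≤-antisym
    (d≤ e (trans (Power.×-congʳ monoid (suc e) x≈y) q))
    (e≤ d (trans (Power.×-congʳ monoid (suc d) (sym x≈y)) p))

order-embedding : ∀ {A B} (e : Embedding A B) {x d} →
  HasOrder1+ A x d → HasOrder1+ B (Embedding.to e x) d
order-embedding {A} {B} e {x} {d} (p , d≤) =
    B.trans (B.sym (pow-homo e (suc d) x)) (B.trans (e.⟦⟧-cong p) e.ε-homo)
  , λ k q → d≤ k (e.injective (B.trans (pow-homo e (suc k) x) (B.trans q (B.sym e.ε-homo))))
  where
  module B = Group B
  module e = Embedding e

-- An order is not changed by a trivial first component.
order-⊗ : ∀ (A B : Grp) {x y d} → Group._≈_ A x (Group.ε A) → HasOrder1+ B y d →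
  HasOrder1+ (A ⊗ B) (x , y) d
order-⊗ A B {x} {y} {d} x≈ε (p , d≤) =
    ( A.trans (A.reflexive (cong proj₁ (pow-⊗ (suc d))))
        (A.trans (Power.×-congʳ A.monoid (suc d) x≈ε) (pow-ε A (suc d)))
    , B.trans (B.reflexive (cong proj₂ (pow-⊗ (suc d)))) p)
  , λ e (_ , q) → d≤ e (B.trans (B.reflexive (≡.sym (cong proj₂ (pow-⊗ (suc e))))) q)
  where
  module A = Group A
  module B = Group B
  pow-⊗ : ∀ k → pow (A ⊗ B) k (x , y) ≡ (pow A k x , pow B k y)
  pow-⊗ zero    = refl
  pow-⊗ (suc k) = cong (Group._∙_ (A ⊗ B) (x , y)) (pow-⊗ k)

-- Finite groups

FiniteSetoid : Setoid 0ℓ 0ℓ → Set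
FiniteSetoid S = ∃ λ n → Bijection S (≡.setoid (Fin n))

finite-×ₛ : ∀ {S T} → FiniteSetoid S → FiniteSetoid T → FiniteSetoid (S ×ₛ T)
finite-×ₛ (m , f) (n , g) = m * n , record
  { to        = λ (x , y) → Fin.combine (f.to x) (g.to y)
  ; cong      = λ (p , q) → ≡.cong₂ Fin.combine (f.cong p) (g.cong q)
  ; bijective =
      (λ {(x , y)} {(x′ , y′)} eq →
        let p , q = Fin.combine-injective (f.to x) (g.to y) (f.to x′) (g.to y′) eq
        in f.injective p , g.injective q)
    , λ k → let i , j , eq = Fin.combine-surjective k
                x , p = f.surjective i
                y , q = g.surjective j
            in (x , y) , λ (r , s) → ≡.trans (≡.cong₂ Fin.combine (p r) (q s)) eq
  }
  where
  module f = Bijection f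
  module g = Bijection g

finite-⊗ : ∀ {G H} → Finite G → Finite H → Finite (G ⊗ H)
finite-⊗ {G} {H} = finite-×ₛ {Group.setoid G} {Group.setoid H}

finite-Bool : FiniteSetoid (≡.setoid Bool)
finite-Bool = 2 , Inverse⇒Bijection (Symmetry.inverse Fin.2↔Bool)

-- The group of order two is Bool under exclusive or; true is its involution.
C₂ : Grp
C₂ = CommutativeRing.+-group Bool.xor-∧-commutativeRing

finite-C₂ : Finite C₂
finite-C₂ = finite-Bool

-- The embedding of the group of order two given by an involution y.
involution : ∀ {G : Grp} {y} → Involutive G y → ¬ Group._≈_ G y (Group.ε G) → Embedding C₂ G
involution {G} {y} y²≈ε y≉ε = mkEmbedding
  (mkHomomorphism {C₂} {G} f (λ { refl → G.refl }) homo) inj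
  where
  module G = Group G
  f : Bool → G.Carrier
  f s = if s then y else G.ε
  homo : ∀ s t → f (s xor t) G.≈ f s G.∙ f t
  homo false t     = G.sym (G.identityˡ _)
  homo true  false = G.sym (G.identityʳ _)
  homo true  true  = G.sym y²≈ε
  inj : ∀ {s t} → f s G.≈ f t → s ≡ t
  inj {false} {false} _ = refl
  inj {false} {true}  p = contradiction (G.sym p) y≉ε
  inj {true}  {false} p = contradiction p y≉ε
  inj {true}  {true}  _ = refl

-- Dihedral groups

-- The dihedral group of order 2n, n = 1 + p, on pairs of a natural number modulo n and
-- a Boolean.  The pair (k , s) stands for the rotation by k, followed on the right by the
-- basic reflection if s is true.  Conjugation by that reflection negates k, and -1 is
-- represented by p modulo n, so no integers are needed.
module Dihedral (p : ℕ) where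
  n : ℕ
  n = suc p

  infix 4 _≡ₙ_
  _≡ₙ_ : ℕ → ℕ → Set
  k ≡ₙ l = k % n ≡ l % n

  residues : Setoid 0ℓ 0ℓ
  residues = record
    { Carrier = ℕ ; _≈_ = _≡ₙ_
    ; isEquivalence = record { refl = refl ; sym = ≡.sym ; trans = ≡.trans } }

  setoid : Setoid 0ℓ 0ℓ
  setoid = residues ×ₛ ≡.setoid Bool

  +-congₙ : ∀ {k k′ l l′} → k ≡ₙ k′ → l ≡ₙ l′ → k + l ≡ₙ k′ + l′
  +-congₙ {k} {k′} {l} {l′} p q = ≡.trans (%-distribˡ-+ k l n)
    (≡.trans (cong (_% n) (≡.cong₂ _+_ p q)) (≡.sym (%-distribˡ-+ k′ l′ n)))

  p*-congₙ : ∀ {k k′} → k ≡ₙ k′ → p * k ≡ₙ p * k′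
  p*-congₙ {k} {k′} q = ≡.trans (%-distribˡ-* p k n)
    (≡.trans (cong (λ r → (p % n * r) % n) q) (≡.sym (%-distribˡ-* p k′ n)))

  p*p*-identity : ∀ k → p * (p * k) ≡ₙ k
  p*p*-identity k = begin
    p * (p * k) % n             ≡⟨ [m+kn]%n≡m%n (p * (p * k)) k n ⟨
    (p * (p * k) + k * n) % n   ≡⟨ cong (_% n) (lemma p k) ⟩
    (k + p * k * n) % n         ≡⟨ [m+kn]%n≡m%n k (p * k) n ⟩
    k % n                       ∎
    where
    open ≡.≡-Reasoning
    lemma : ∀ p k → p * (p * k) + k * suc p ≡ k + p * k * suc p
    lemma = solve-∀

  -- The conjugate of the rotation by k under the power s of the basic reflection is the
  -- rotation by twist s k.
  twist : Bool → ℕ → ℕ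
  twist false k = k
  twist true  k = p * k

  twist-cong : ∀ s {k l} → k ≡ₙ l → twist s k ≡ₙ twist s l
  twist-cong false = id
  twist-cong true  = p*-congₙ

  private
    infixl 7 _∙_
    _∙_ : ℕ × Bool → ℕ × Bool → ℕ × Bool
    (k , s) ∙ (l , t) = k + twist s l , s xor t

    _⁻¹ : ℕ × Bool → ℕ × Bool
    (k , false) ⁻¹ = p * k , false
    (k , true)  ⁻¹ = k , true

    open Setoid setoid using (_≈_)

    n*k≡ₙ0 : ∀ k → n * k ≡ₙ 0
    n*k≡ₙ0 k = ≡.trans (cong (_% n) (ℕ.*-comm n k)) (m*n%n≡0 k n)

    ∙-assoc : ∀ x y z → (x ∙ y) ∙ z ≈ x ∙ (y ∙ z)
    ∙-assoc (k , s) (l , t) (j , u) = rot s t , Bool.xor-assoc s t u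
      where
      rot : ∀ s t → k + twist s l + twist (s xor t) j ≡ₙ k + twist s (l + twist t j)
      rot false t     = cong (_% n) (ℕ.+-assoc k l _)
      rot true  false = cong (_% n) (lemma k l j p)
        where
        lemma : ∀ k l j p → k + p * l + p * j ≡ k + p * (l + j)
        lemma = solve-∀
      rot true  true  = ≡.trans
        (+-congₙ {k + p * l} {k + p * l} {j} {p * (p * j)} refl (≡.sym (p*p*-identity j)))
        (cong (_% n) (lemma k l j p))
        where
        lemma : ∀ k l j p → k + p * l + p * (p * j) ≡ k + p * (l + p * j)
        lemma = solve-∀

    ∙-cong : ∀ {x x′ y y′} → x ≈ x′ → y ≈ y′ → x ∙ y ≈ x′ ∙ y′
    ∙-cong {k , s} {k′ , _} {l , _} {l′ , _} (q , refl) (r , refl) =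
      +-congₙ {k} {k′} q (twist-cong s {l} {l′} r) , refl

    ∙-identityʳ : ∀ x → x ∙ (0 , false) ≈ x
    ∙-identityʳ (k , false) = cong (_% n) (ℕ.+-identityʳ k) , refl
    ∙-identityʳ (k , true)  =
      cong (_% n) (≡.trans (cong (k +_) (ℕ.*-zeroʳ p)) (ℕ.+-identityʳ k)) , refl

    ∙-inverseˡ : ∀ x → (x ⁻¹) ∙ x ≈ (0 , false)
    ∙-inverseˡ (k , false) = ≡.trans (cong (_% n) (ℕ.+-comm (p * k) k)) (n*k≡ₙ0 k) , refl
    ∙-inverseˡ (k , true)  = n*k≡ₙ0 k , refl

    ∙-inverseʳ : ∀ x → x ∙ (x ⁻¹) ≈ (0 , false)
    ∙-inverseʳ (k , false) = n*k≡ₙ0 k , refl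
    ∙-inverseʳ (k , true)  = n*k≡ₙ0 k , refl

    ∙-⁻¹-cong : ∀ {x y} → x ≈ y → x ⁻¹ ≈ y ⁻¹
    ∙-⁻¹-cong {k , false} {l , _} (q , refl) = p*-congₙ {k} {l} q , refl
    ∙-⁻¹-cong {k , true}  (q , refl) = q , refl

  dihedral : Grp
  dihedral = record
    { Carrier = ℕ × Bool
    ; _≈_     = _≈_
    ; _∙_     = _∙_
    ; ε       = 0 , false
    ; _⁻¹     = _⁻¹
    ; isGroup = record
      { isMonoid = record
        { isSemigroup = record
          { isMagma = record
            { isEquivalence = Setoid.isEquivalence setoid
            ; ∙-cong        = λ {x} {y} {u} {v} → ∙-cong {x} {y} {u} {v}
            }
          ; assoc = ∙-assoc
          }
        ; identity = (λ _ → refl , refl) , ∙-identityʳ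
        }
      ; inverse = ∙-inverseˡ , ∙-inverseʳ
      ; ⁻¹-cong = ∙-⁻¹-cong
      }
    }

  finite : Finite dihedral
  finite = finite-×ₛ {residues} (n , record
    { to        = _mod n
    ; cong      = λ {k} {l} q → Fin.toℕ-injective
        (≡.trans (toℕ-mod k) (≡.trans q (≡.sym (toℕ-mod l))))
    ; bijective =
        (λ {k} {l} q → ≡.trans (≡.sym (toℕ-mod k)) (≡.trans (cong toℕ q) (toℕ-mod l)))
      , λ i → toℕ i , λ {k} q → Fin.toℕ-injective
          (≡.trans (toℕ-mod k) (≡.trans q (m<n⇒m%n≡m (Fin.toℕ<n i))))
    }) finite-Bool
    where
    toℕ-mod : ∀ k → toℕ (k mod n) ≡ k % n
    toℕ-mod k = Fin.toℕ-fromℕ< (m%n<n k n)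

  reflection : ℕ → ℕ × Bool
  reflection i = i , true

  reflection² : ∀ i → reflection i ∙ reflection i ≈ (0 , false)
  reflection² = ∙-inverseˡ ∘ reflection

  reflection≉ε : ∀ i → ¬ reflection i ≈ (0 , false)
  reflection≉ε i (_ , ())

  pow-rotation : ∀ d k → pow dihedral d (k , false) ≈ (d * k , false)
  pow-rotation zero    k = refl , refl
  pow-rotation (suc d) k =
    ∙-cong {k , false} {k , false} {_} {d * k , false} (refl , refl) (pow-rotation d k)

  rotation^n≈ε : ∀ k → pow dihedral n (k , false) ≈ (0 , false)
  rotation^n≈ε k = ≡.trans (proj₁ (pow-rotation n k)) (n*k≡ₙ0 k) , proj₂ (pow-rotation n k)

  -- Two reflections whose product is the rotation by one.
  α β : ℕ × Bool
  α = reflection 1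
  β = reflection 0

  αβ-order : HasOrder1+ dihedral (α ∙ β) p
  αβ-order = rotation^n≈ε (1 + p * 0) , λ e q → s≤s⁻¹ (∣⇒≤ (m%n≡0⇒n∣m (suc e) n (begin
      suc e % n                     ≡⟨ cong (_% n) (lemma (suc e) p) ⟨
      (suc e * (1 + p * 0)) % n     ≡⟨ proj₁ (pow-rotation (suc e) (1 + p * 0)) ⟨
      proj₁ (pow dihedral (suc e) (α ∙ β)) % n  ≡⟨ proj₁ q ⟩
      0                             ∎)))
    where
    open ≡.≡-Reasoning
    lemma : ∀ e p → e * (1 + p * 0) ≡ e
    lemma = solve-∀

-- Elements g and h of a group that satisfy the dihedral relations define a homomorphism
-- from the presented group.
module Evaluation {n : ℕ} (G : Grp) (g h : Group.Carrier G)
  (g² : Involutive G g) (h² : Involutive G h)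
  (gh^n : Period G n (Group._∙_ G g h)) (hg^n : Period G n (Group._∙_ G h g)) where

  private
    module G = Group G
  open Group G using (Carrier; _≈_; _∙_; ε)

  eval : Term DihedralGen → Carrier
  eval (var a)  = g
  eval (var b)  = h
  eval εₜ       = ε
  eval (s · t)  = eval s ∙ eval t
  eval (t ⁻¹ₜ)  = eval t G.⁻¹

  eval-^ : ∀ t k → eval (t ^ k) ≡ pow G k (eval t)
  eval-^ t zero    = refl
  eval-^ t (suc k) = cong (eval t ∙_) (eval-^ t k)

  open Presentation (DihedralRelator n)

  eval-cong : ∀ {s t} → s ~ t → eval s ≈ eval t
  eval-cong ~-refl              = G.refl
  eval-cong (~-sym p)           = G.sym (eval-cong p)
  eval-cong (~-trans p q)       = G.trans (eval-cong p) (eval-cong q)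
  eval-cong (·-cong p q)        = G.∙-cong (eval-cong p) (eval-cong q)
  eval-cong (⁻¹-cong p)         = G.⁻¹-cong (eval-cong p)
  eval-cong (assoc s t u)       = G.assoc _ _ _
  eval-cong (idˡ s)             = G.identityˡ _
  eval-cong (idʳ s)             = G.identityʳ _
  eval-cong (invˡ s)            = G.inverseˡ _
  eval-cong (invʳ s)            = G.inverseʳ _
  eval-cong (relator a²)        = G.trans (G.∙-congˡ (G.identityʳ g)) g²
  eval-cong (relator b²)        = G.trans (G.∙-congˡ (G.identityʳ h)) h²
  eval-cong (relator [ab]^n)    = G.trans (G.reflexive (eval-^ (var a · var b) n)) gh^n
  eval-cong (relator [ba]^n)    = G.trans (G.reflexive (eval-^ (var b · var a) n)) hg^n

  evaluation : Homomorphism (D n) G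
  evaluation = mkHomomorphism {D n} {G} eval eval-cong (λ _ _ → G.refl)

-- Evaluation at α and β is an embedding of the presented group into the concrete one: each
-- term equals a normal form ρ^k τ^s, ρ = a b and τ = b, and the exponents k modulo n and
-- s can be read off from the value of the term.
module Faithful (p : ℕ) where
  open Dihedral p
  open Group dihedral using () renaming (_≈_ to _≋_; _∙_ to _⊙_)
  open Group (D n) hiding (_⁻¹; refl)
  open Power monoid renaming (_×_ to _⋆_)
  open Evaluation {n} dihedral α β (reflection² 1) (reflection² 0)
    (rotation^n≈ε _) (rotation^n≈ε _)
  open ≈-Reasoning (Group.setoid (D n))
  open Presentation (DihedralRelator n) using (relator)

  ρ τ : Carrier
  ρ = var a · var b
  τ = var b

  τ² : τ ∙ τ ≈ ε
  τ² = trans (∙-congˡ (sym (identityʳ τ))) (relator b²)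

  ^-⋆ : ∀ t k → t ^ k ≡ k ⋆ t
  ^-⋆ t zero    = refl
  ^-⋆ t (suc k) = cong (t ·_) (^-⋆ t k)

  ρ^n : n ⋆ ρ ≈ ε
  ρ^n = trans (reflexive (≡.sym (^-⋆ ρ n))) (relator [ab]^n)

  -- The power s of τ.
  flip : Bool → Carrier
  flip s = if s then τ else ε

  -- The normal form of exponents k and s.
  term : ℕ × Bool → Carrier
  term (k , s) = k ⋆ ρ ∙ flip s

  multiple-of-n : ∀ k → (k * n) ⋆ ρ ≈ ε
  multiple-of-n k = begin
    (k * n) ⋆ ρ   ≈⟨ ×-assocˡ ρ k n ⟨
    k ⋆ (n ⋆ ρ)   ≈⟨ ×-congʳ k ρ^n ⟩
    k ⋆ ε         ≈⟨ pow-ε (D n) k ⟩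
    ε             ∎

  ρ-mod : ∀ k → k ⋆ ρ ≈ (k % n) ⋆ ρ
  ρ-mod k = begin
    k ⋆ ρ                           ≈⟨ ×-congˡ (m≡m%n+[m/n]*n k n) ⟩
    (k % n + k / n * n) ⋆ ρ         ≈⟨ ×-homo-+ ρ (k % n) (k / n * n) ⟩
    (k % n) ⋆ ρ ∙ (k / n * n) ⋆ ρ   ≈⟨ ∙-congˡ (multiple-of-n (k / n)) ⟩
    (k % n) ⋆ ρ ∙ ε                 ≈⟨ identityʳ _ ⟩
    (k % n) ⋆ ρ                     ∎

  term-cong : ∀ {x y} → x ≋ y → term x ≈ term y
  term-cong {k , s} {l , _} (q , refl) = ∙-congʳ (begin
    k ⋆ ρ         ≈⟨ ρ-mod k ⟩
    (k % n) ⋆ ρ   ≈⟨ ×-congˡ q ⟩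
    (l % n) ⋆ ρ   ≈⟨ ρ-mod l ⟨
    l ⋆ ρ         ∎)

  a∙a : var a ∙ var a ≈ ε
  a∙a = trans (∙-congˡ (sym (identityʳ _))) (relator a²)

  -- Both sides are inverse to ρ.
  τ∙a : τ ∙ var a ≈ p ⋆ ρ
  τ∙a = begin
    τ ∙ var a                      ≈⟨ identityʳ _ ⟨
    τ ∙ var a ∙ ε                  ≈⟨ ∙-congˡ ρ^n ⟨
    τ ∙ var a ∙ (ρ ∙ p ⋆ ρ)        ≈⟨ Group.assoc (D n) _ _ _ ⟨
    τ ∙ var a ∙ (var a ∙ τ) ∙ p ⋆ ρ
      ≈⟨ ∙-congʳ (trans (Group.assoc (D n) τ (var a) (var a ∙ τ))
           (∙-congˡ (trans (sym (Group.assoc (D n) (var a) (var a) τ))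
             (trans (∙-congʳ a∙a) (identityˡ τ))))) ⟩
    τ ∙ τ ∙ p ⋆ ρ                  ≈⟨ ∙-congʳ τ² ⟩
    ε ∙ p ⋆ ρ                      ≈⟨ identityˡ _ ⟩
    p ⋆ ρ                          ∎

  τ-ρ : ∀ l → τ ∙ l ⋆ ρ ≈ (p * l) ⋆ ρ ∙ τ
  τ-ρ zero = begin
    τ ∙ ε                ≈⟨ identityʳ τ ⟩
    τ                    ≈⟨ identityˡ τ ⟨
    ε ∙ τ                ≈⟨ ∙-congʳ (×-congˡ {ρ} (≡.sym (ℕ.*-zeroʳ p))) ⟩
    (p * 0) ⋆ ρ ∙ τ      ∎
  τ-ρ (suc l) = begin
    τ ∙ (var a ∙ τ ∙ l ⋆ ρ)          ≈⟨ ∙-congˡ (Group.assoc (D n) _ _ _) ⟩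
    τ ∙ (var a ∙ (τ ∙ l ⋆ ρ))        ≈⟨ Group.assoc (D n) _ _ _ ⟨
    τ ∙ var a ∙ (τ ∙ l ⋆ ρ)          ≈⟨ ∙-cong τ∙a (τ-ρ l) ⟩
    p ⋆ ρ ∙ ((p * l) ⋆ ρ ∙ τ)        ≈⟨ Group.assoc (D n) _ _ _ ⟨
    p ⋆ ρ ∙ (p * l) ⋆ ρ ∙ τ          ≈⟨ ∙-congʳ (×-homo-+ ρ p (p * l)) ⟨
    (p + p * l) ⋆ ρ ∙ τ              ≈⟨ ∙-congʳ (×-congˡ {ρ} (≡.sym (ℕ.*-suc p l))) ⟩
    (p * suc l) ⋆ ρ ∙ τ              ∎

  flip-ρ : ∀ s l → flip s ∙ l ⋆ ρ ≈ (twist s l) ⋆ ρ ∙ flip s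
  flip-ρ false l = trans (identityˡ _) (sym (identityʳ _))
  flip-ρ true  l = τ-ρ l

  flip-xor : ∀ s t → flip s ∙ flip t ≈ flip (s xor t)
  flip-xor false t     = identityˡ _
  flip-xor true  false = identityʳ _
  flip-xor true  true  = τ²

  term-∙ : ∀ x y → term (x ⊙ y) ≈ term x ∙ term y
  term-∙ (k , s) (l , t) = sym (begin
    (k ⋆ ρ ∙ flip s) ∙ (l ⋆ ρ ∙ flip t)          ≈⟨ Group.assoc (D n) _ _ _ ⟩
    k ⋆ ρ ∙ (flip s ∙ (l ⋆ ρ ∙ flip t))          ≈⟨ ∙-congˡ (Group.assoc (D n) _ _ _) ⟨
    k ⋆ ρ ∙ (flip s ∙ l ⋆ ρ ∙ flip t)            ≈⟨ ∙-congˡ (∙-congʳ (flip-ρ s l)) ⟩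
    k ⋆ ρ ∙ (twist s l ⋆ ρ ∙ flip s ∙ flip t)    ≈⟨ ∙-congˡ (Group.assoc (D n) _ _ _) ⟩
    k ⋆ ρ ∙ (twist s l ⋆ ρ ∙ (flip s ∙ flip t))  ≈⟨ Group.assoc (D n) _ _ _ ⟨
    k ⋆ ρ ∙ twist s l ⋆ ρ ∙ (flip s ∙ flip t)
      ≈⟨ ∙-cong (sym (×-homo-+ ρ k (twist s l))) (flip-xor s t) ⟩
    (k + twist s l) ⋆ ρ ∙ flip (s xor t)         ∎)

  normalForm : Homomorphism dihedral (D n)
  normalForm = mkHomomorphism {dihedral} {D n} term (λ {x} {y} → term-cong {x} {y}) term-∙

  term-eval : ∀ t → term (eval t) ≈ t
  term-eval (var a)  = begin
    var a ∙ τ ∙ ε ∙ τ       ≈⟨ ∙-congʳ (identityʳ _) ⟩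
    var a ∙ τ ∙ τ           ≈⟨ Group.assoc (D n) _ _ _ ⟩
    var a ∙ (τ ∙ τ)         ≈⟨ ∙-congˡ τ² ⟩
    var a ∙ ε               ≈⟨ identityʳ _ ⟩
    var a                   ∎
  term-eval (var b)  = identityˡ _
  term-eval εₜ       = identityˡ _
  term-eval (s · t)  = trans (term-∙ (eval s) (eval t)) (∙-cong (term-eval s) (term-eval t))
  term-eval (t ⁻¹ₜ)  = trans (Homomorphism.⁻¹-homo normalForm (eval t))
    (Group.⁻¹-cong (D n) (term-eval t))

  faithful : Embedding (D n) dihedral
  faithful = mkEmbedding evaluation λ {s} {t} q →
    trans (sym (term-eval s)) (trans (term-cong {eval s} {eval t} q) (term-eval t))

-- Generated subgroups and periods

-- The least element of an inhabited decidable set of natural numbers.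
least : ∀ {P : Pred ℕ 0ℓ} → Unary.Decidable P → ∀ {n} → P n →
  ∃ λ d → P d × (∀ e → P e → d ≤ e)
least {P} P? {n} Pn with search (suc n)
  where
  search : ∀ k → (∃ λ d → P d × (∀ e → P e → d ≤ e)) ⊎ (∀ e → P e → k ≤ e)
  search zero = inj₂ λ _ _ → z≤n
  search (suc k) with search k | P? k
  ... | inj₁ found | _      = inj₁ found
  ... | inj₂ k≤    | yes Pk = inj₁ (k , Pk , k≤)
  ... | inj₂ k≤    | no ¬Pk = inj₂ λ e Pe →
    ℕ.≤∧≢⇒< (k≤ e Pe) λ { refl → ¬Pk Pe }
... | inj₁ found = found
... | inj₂ n<    = contradiction (n< n Pn) ℕ.1+n≰n

module _ (G : Grp) where
  open Group G

  -- The subgroup generated by a list.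
  generated : List Carrier → Subgroup G
  generated gs = record
    { group = record
      { Carrier = Σ Carrier (Generated G gs)
      ; _≈_     = λ x y → proj₁ x ≈ proj₁ y
      ; _∙_     = λ (x , p) (y , q) → x ∙ y , mul p q
      ; ε       = ε , unit
      ; _⁻¹     = λ (x , p) → x ⁻¹ , inv p
      ; isGroup = record
        { isMonoid = record
          { isSemigroup = record
            { isMagma = record
              { isEquivalence = record { refl = Group.refl G ; sym = sym ; trans = trans }
              ; ∙-cong        = ∙-cong
              }
            ; assoc = λ _ _ _ → assoc _ _ _
            }
          ; identity = (λ _ → identityˡ _) , (λ _ → identityʳ _)
          }
        ; inverse = (λ _ → inverseˡ _) , (λ _ → inverseʳ _)
        ; ⁻¹-cong = ⁻¹-cong
        }
      }
    ; inclusion = record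
      { to = proj₁
      ; isGroupMonomorphism = record
        { isGroupHomomorphism = record
          { isMonoidHomomorphism = record
            { isMagmaHomomorphism = record
              { isRelHomomorphism = record { cong = id }
              ; homo              = λ _ _ → Group.refl G
              }
            ; ε-homo = Group.refl G
            }
          ; ⁻¹-homo = λ _ → Group.refl G
          }
        ; injective = id
        }
      }
    }

  cyclic : Carrier → Subgroup G
  cyclic x = generated (x ∷ [])

  cyclic-fg : ∀ x → FinitelyGenerated (Subgroup.group (cyclic x))
  cyclic-fg x = (x , gen (here (Group.refl G))) ∷ [] , λ (_ , p) → go p
    where
    go : ∀ {y} (p : Generated G (x ∷ []) y) →
      Generated (Subgroup.group (cyclic x)) ((x , gen (here (Group.refl G))) ∷ []) (y , p)
    go (gen (here y≈x)) = gen (here y≈x)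
    go unit             = unit
    go (mul p q)        = mul (go p) (go q)
    go (inv p)          = inv (go p)
    go (resp y≈z p)     = resp y≈z (go p)

  -- Two of the first 1 + n powers of x coincide when the group has n elements.
  periodic : Finite G → ∀ x → ∃ λ d → Period G (suc d) x
  periodic (n , f) x
    with i , j , i<j , eq ← Fin.pigeonhole (ℕ.n<1+n n) (λ i → Bijection.to f (pow G (toℕ i) x))
    = toℕ j ∸ suc (toℕ i) , identityʳ-unique (pow G (toℕ i) x) _ (begin
        pow G (toℕ i) x ∙ pow G (suc (toℕ j ∸ suc (toℕ i))) x
          ≈⟨ ×-homo-+ x (toℕ i) _ ⟨
        pow G (toℕ i + suc (toℕ j ∸ suc (toℕ i))) x
          ≈⟨ ×-congˡ (≡.trans (ℕ.+-suc (toℕ i) _) (ℕ.m+[n∸m]≡n i<j)) ⟩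
        pow G (toℕ j) x
          ≈⟨ Bijection.injective f eq ⟨
        pow G (toℕ i) x  ∎)
    where
    open GroupProperties G using (identityʳ-unique)
    open Power monoid using (×-homo-+; ×-congˡ)
    open ≈-Reasoning setoid

D-fg : ∀ n → FinitelyGenerated (D n)
D-fg n = var a ∷ var b ∷ [] , go
  where
  open Presentation (DihedralRelator n) using (~-refl)
  go : ∀ t → Generated (D n) (var a ∷ var b ∷ []) t
  go (var a)  = gen (here ~-refl)
  go (var b)  = gen (there (here ~-refl))
  go εₜ       = unit
  go (s · t)  = mul (go s) (go t)
  go (t ⁻¹ₜ)  = inv (go t)

-- For an involution y, the homomorphisms to G that send one generator to the unit and the
-- other one to y.  They exist because the exponent 2m of a b is even.
module _ (G : Grp) (y : Group.Carrier G) (y²≈ε : Involutive G y) (m : ℕ) where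
  open Group G
  private
    ε∙y : Period G (2 * m) (ε ∙ y)
    ε∙y = trans (Power.×-congʳ monoid (2 * m) (identityˡ y)) (pow-involution G {y} y²≈ε m)

    y∙ε : Period G (2 * m) (y ∙ ε)
    y∙ε = trans (Power.×-congʳ monoid (2 * m) (identityʳ y)) (pow-involution G {y} y²≈ε m)

  collapse-a : Homomorphism (D (2 * m)) G
  collapse-a = Evaluation.evaluation G ε y (identityˡ ε) y²≈ε ε∙y y∙ε

  collapse-b : Homomorphism (D (2 * m)) G
  collapse-b = Evaluation.evaluation G y ε y²≈ε (identityˡ ε) y∙ε ε∙y

-- Hall's universal group and the colouring

module HallGroup (H : Grp) (hall : IsHallUniversalGroup H) where
  open IsHallUniversalGroup hall
  open Group H hiding (refl)
  private
    module enum = Bijection countable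

  enum : ℕ → Carrier
  enum = enum.to

  -- The index of an element in the enumeration.
  ind : Carrier → ℕ
  ind x = proj₁ (enum.surjective x)

  enum-ind : ∀ x → enum (ind x) ≈ x
  enum-ind x = proj₂ (enum.surjective x) refl

  ind-cong : ∀ {x y} → x ≈ y → ind x ≡ ind y
  ind-cong x≈y = enum.injective (trans (enum-ind _) (trans x≈y (sym (enum-ind _))))

  ind-injective : ∀ {x y} → ind x ≡ ind y → x ≈ y
  ind-injective eq = trans (sym (enum-ind _)) (trans (reflexive (cong enum eq)) (enum-ind _))

  _≈?_ : Decidable _≈_
  x ≈? y = map′ ind-injective ind-cong (ind x ℕ.≟ ind y)

  abstract
    -- Local finiteness of the cyclic subgroup generated by x gives a positive period, and
    -- the least one is found since equality is decidable.  The value is never unfolded.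
    order : ∀ x → ∃ (HasOrder1+ H x)
    order x = let d , xᵈ≈ε = period in least (λ d → pow H (suc d) x ≈? ε) {d}
        (trans (sym (pow-homo inclusion (suc d) x′)) xᵈ≈ε)
      where
      open Subgroup (cyclic H x)
      x′ : Group.Carrier group
      x′ = x , gen (here (Group.refl H))
      period : ∃ λ d → Group._≈_ group (pow group (suc d) x′) (Group.ε group)
      period = periodic group (locallyFinite (cyclic H x) (cyclic-fg H x)) x′

  -- Extension property: an embedding ι of A extends along j : A → F for finite F.  Some
  -- embedding κ₀ of F exists; an automorphism moves the copy of A given by κ₀ ∘ j to that
  -- given by ι.
  extend : ∀ {A F : Grp} → Finite A → Finite F → (j : Embedding A F) (ι : Embedding A H) →
    ∃ λ (κ : Embedding F H) → ∀ x → Embedding.to κ (Embedding.to j x) ≈ Embedding.to ι x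
  extend {A} {F} finA finF j ι = σ̂ ∘ₑ κ₀ , proj₂ extension
    where
    κ₀ : Embedding F H
    κ₀ = embedsFiniteGroups F finF
    extension = ultrahomogeneous
      (record { group = A ; inclusion = κ₀ ∘ₑ j }) (record { group = A ; inclusion = ι })
      finA finA
      (record { to = id
              ; isGroupIsomorphism = Identity.isGroupIsomorphism (Group.rawGroup A) (Group.refl A) })
    σ̂ : Embedding H H
    σ̂ = record
      { to = Isomorphism.to (proj₁ extension)
      ; isGroupMonomorphism = IsGroupIsomorphism.isGroupMonomorphism
          (Isomorphism.isGroupIsomorphism (proj₁ extension)) }

  -- One less than the order of x times the n-th element.
  profile : Carrier → ℕ → ℕ
  profile x n = proj₁ (order (x ∙ enum n))

  profile-cong : ∀ {x y} → x ≈ y → ∀ n → profile x n ≡ profile y n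
  profile-cong {x} {y} x≈y n = order-unique H (∙-congʳ x≈y)
    (proj₂ (order (x ∙ enum n))) (proj₂ (order (y ∙ enum n)))

  -- The colour of the index of y under the sequence profile x.
  pairColor : Carrier → Carrier → ℕ
  pairColor x y = color (profile x) (ind y)

  pairColor-cong : ∀ {x x′ y y′} → x ≈ x′ → y ≈ y′ → pairColor x y ≡ pairColor x′ y′
  pairColor-cong {x} {x′} {y} x≈ y≈ =
    ≡.trans (color-cong (profile-cong x≈) (ind y)) (cong (color (profile x′)) (ind-cong y≈))

  -- The colours are natural numbers reduced modulo the number of colours.
  coloring : ∀ n k → Coloring (D n) H (suc k)
  coloring n k = record
    { to   = λ f → pairColor (Embedding.to f (var a)) (Embedding.to f (var b)) mod suc k
    ; cong = λ f≈g → cong (_mod suc k) (pairColor-cong (f≈g (var a)) (f≈g (var b)))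
    }

  profile-order : ∀ {x h d} → HasOrder1+ H (x ∙ h) d → profile x (ind h) ≡ d
  profile-order {x} {h} xh-order =
    order-unique H (∙-congˡ (enum-ind h)) (proj₂ (order (x ∙ enum (ind h)))) xh-order

  -- If the order of x v encodes the colour c and the indices of the images of the y s under
  -- w, then, w preserving the order of x v, some pair (w x , w (y s)) gets the colour c.
  pairColor-attained : ∀ (w : Embedding H H) (let module w = Embedding w) v x
    (y : Fin (capacity (ind (w.to v))) → Carrier) → (∀ {s t} → y s ≈ y t → s ≡ t) → ∀ c →
    HasOrder1+ H (x ∙ v) (encode (c ∷ tabulate (λ s → ind (w.to (y s))))) →
    ∃ λ s → pairColor (w.to x) (w.to (y s)) ≡ c
  pairColor-attained w v x y y-inj c xv-order =
    color-attained (profile (w.to x)) (ind (w.to v)) c (λ s → ind (w.to (y s)))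
      (y-inj ∘ w.injective ∘ ind-injective)
      (≡.trans
        (cong decode (profile-order (order-cong H (w.∙-homo x v) (order-embedding w xv-order))))
        (decode-encode _))
    where module w = Embedding w

  coloring-value : ∀ n k (f : Embedding (D n) H) {x y} (c : Fin (suc k)) →
    Embedding.to f (var a) ≈ x → Embedding.to f (var b) ≈ y → pairColor x y ≡ toℕ c →
    Func.to (coloring n k) f ≡ c
  coloring-value n k f {x} {y} c fa≈x fb≈y eq = Fin.toℕ-injective (begin
    toℕ (pairColor fa fb mod suc k)   ≡⟨ Fin.toℕ-fromℕ< (m%n<n (pairColor fa fb) (suc k)) ⟩
    pairColor fa fb % suc k           ≡⟨ cong (_% suc k) (pairColor-cong fa≈x fb≈y) ⟩
    pairColor x y % suc k             ≡⟨ cong (_% suc k) eq ⟩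
    toℕ c % suc k                     ≡⟨ m<n⇒m%n≡m (Fin.toℕ<n c) ⟩
    toℕ c                             ∎)
    where
    open ≡.≡-Reasoning
    fa = Embedding.to f (var a)
    fb = Embedding.to f (var b)

  -- The same for embeddings f s that send the generators to x and y s.
  colorAttained : ∀ n k (w : Embedding H H) (let module w = Embedding w) (c : Fin (suc k)) v x
    (y : Fin (capacity (ind (w.to v))) → Carrier) → (∀ {s t} → y s ≈ y t → s ≡ t) →
    (f : Fin (capacity (ind (w.to v))) → Embedding (D n) H) →
    (∀ s → Embedding.to (f s) (var a) ≈ x) → (∀ s → Embedding.to (f s) (var b) ≈ y s) →
    HasOrder1+ H (x ∙ v) (encode (toℕ c ∷ tabulate (λ s → ind (w.to (y s))))) →
    ColorsOn {D n} {H} (coloring n k) w c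
  colorAttained n k w c v x y y-inj f fa≈x fb≈y xv-order =
    let s , eq = pairColor-attained w v x y y-inj (toℕ c) xv-order
    in f s , coloring-value n k (w ∘ₑ f s) c (w.⟦⟧-cong (fa≈x s)) (w.⟦⟧-cong (fb≈y s)) eq
    where module w = Embedding w

  -- For an involution v of H, given by ι₀, and numbers m > 0, r and q (m is shifted by
  -- one), there are 1 + r distinct elements `partner s` of H, independent of q, and an
  -- element `center` such that center v has order 1 + q, and for each s an embedding of the
  -- dihedral group D (2m) into H sends the generators to center and partner s.
  module Configuration (ι₀ : Embedding C₂ H) (m r : ℕ) where
    -- 1 + p is 2 (1 + m), definitionally.
    p : ℕ
    p = m + suc (m + 0)

    module P = Dihedral p
    module R = Dihedral r
    P R : Grp
    P = P.dihedral
    R = R.dihedral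

    B : Grp
    B = P ⊗ R ⊗ C₂

    finite-B : Finite B
    finite-B = finite-⊗ {P} {R ⊗ C₂} P.finite (finite-⊗ {R} {C₂} R.finite finite-C₂)

    -- The first component is that of x below, so that it cancels in the product x v′.
    v : Group.Carrier B
    v = P.α , Group.ε R , true

    v² : Involutive B v
    v² = P.reflection² 1 , Group.identityˡ R (Group.ε R) , refl

    ι₁-extends : ∃ λ (κ : Embedding B H) →
      ∀ s → Embedding.to κ (if s then v else Group.ε B) ≈ Embedding.to ι₀ s
    ι₁-extends = extend {C₂} {B} finite-C₂ finite-B
      (involution {B} {v} v² λ { (_ , _ , ()) }) ι₀

    ι₁ : Embedding B H
    ι₁ = proj₁ ι₁-extends

    y : Fin (suc r) → Group.Carrier B
    y s = P.β , R.reflection (toℕ s) , false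

    partner : Fin (suc r) → Carrier
    partner s = Embedding.to ι₁ (y s)

    partner-injective : ∀ {s t} → partner s ≈ partner t → s ≡ t
    partner-injective {s} {t} eq = Fin.toℕ-injective (begin
      toℕ s           ≡⟨ m<n⇒m%n≡m (Fin.toℕ<n s) ⟨
      toℕ s % suc r   ≡⟨ proj₁ (proj₁ (proj₂ ys≈yt)) ⟩
      toℕ t % suc r   ≡⟨ m<n⇒m%n≡m (Fin.toℕ<n t) ⟩
      toℕ t           ∎)
      where
      open ≡.≡-Reasoning
      ys≈yt : Group._≈_ B (y s) (y t)
      ys≈yt = Embedding.injective ι₁ {y s} {y t} eq

    module _ (q : ℕ) where
      module Q = Dihedral q
      Q : Grp
      Q = Q.dihedral

      F : Grp
      F = P ⊗ R ⊗ Q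

      finite-F : Finite F
      finite-F = finite-⊗ {P} {R ⊗ Q} P.finite (finite-⊗ {R} {Q} R.finite Q.finite)

      j : Embedding B F
      j = id⊗_ {P} {R ⊗ C₂} {R ⊗ Q} (id⊗_ {R} {C₂} {Q}
            (involution {Q} {Q.β} (Q.reflection² 0) (Q.reflection≉ε 0)))

      ι₂-extends : ∃ λ (κ : Embedding F H) →
        ∀ x → Embedding.to κ (Embedding.to j x) ≈ Embedding.to ι₁ x
      ι₂-extends = extend {B} {F} finite-B finite-F j ι₁

      ι₂ : Embedding F H
      ι₂ = proj₁ ι₂-extends

      -- v′ is the image of v under j.
      x v′ : Group.Carrier F
      x  = P.α , Group.ε R , Q.α
      v′ = P.α , Group.ε R , Q.β

      -- The first component is already injective; in the second one b goes to a reflection and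
      -- a to the unit, in the third one a goes to a reflection and b to the unit.
      g : Fin (suc r) → Embedding (D (suc p)) F
      g s = ⟨_,_⟩ {D (suc p)} {P} {R ⊗ Q} (Faithful.faithful p) (pair {D (suc p)} {R} {Q}
        (collapse-a R (R.reflection (toℕ s)) (R.reflection² (toℕ s)) (suc m))
        (collapse-b Q Q.α (Q.reflection² 1) (suc m)))

      center : Carrier
      center = Embedding.to ι₂ x

      xv′-order : HasOrder1+ F (Group._∙_ F x v′) q
      xv′-order = order-⊗ P (R ⊗ Q) {Group._∙_ P P.α P.α} (P.reflection² 1)
        (order-⊗ R Q {Group._∙_ R (Group.ε R) (Group.ε R)} (Group.identityˡ R (Group.ε R)) Q.αβ-order)

      ι₂v′≈ι₀ : Embedding.to ι₂ v′ ≈ Embedding.to ι₀ true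
      ι₂v′≈ι₀ = trans (proj₂ ι₂-extends v) (proj₂ ι₁-extends true)

      center-order : HasOrder1+ H (center ∙ Embedding.to ι₀ true) q
      center-order = order-cong H {d = q} (trans (Embedding.∙-homo ι₂ x v′) (∙-congˡ ι₂v′≈ι₀))
        (order-embedding ι₂ xv′-order)

      edge : Fin (suc r) → Embedding (D (2 * suc m)) H
      edge s = ι₂ ∘ₑ g s

      edge-a : ∀ s → Embedding.to (edge s) (var a) ≈ center
      edge-a s = Group.refl H {center}

      edge-b : ∀ s → Embedding.to (edge s) (var b) ≈ partner s
      edge-b s = proj₂ ι₂-extends (y s)

  -- The number q, which depends on the indices of the images of the partners, is chosen
  -- after the partners; r is such that 1 + r is the capacity of position n₀.
  allColors : ∀ m k (w : Embedding H H) c →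
    ColorsOn {D (2 * suc m)} {H} (coloring (2 * suc m) k) w c
  allColors m k w c = colorAttained (2 * suc m) k w c
      (Embedding.to ι₀ true) (center q) partner partner-injective
      (edge q) (edge-a q) (edge-b q) (center-order q)
    where
    ι₀ : Embedding C₂ H
    ι₀ = embedsFiniteGroups C₂ finite-C₂

    n₀ : ℕ
    n₀ = ind (Embedding.to w (Embedding.to ι₀ true))

    open Configuration ι₀ m (suc n₀ + room n₀)

    q : ℕ
    q = encode (toℕ c ∷ tabulate (λ s → ind (Embedding.to w (partner s))))

  embedDihedral : ∀ p → Embedding (D (suc p)) H
  embedDihedral p =
    embedsFiniteGroups (Dihedral.dihedral p) (Dihedral.finite p) ∘ₑ Faithful.faithful p

  noBound : ∀ m n → ¬ RamseyBound (D (2 * suc m)) H n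
  noBound m n bound
    with w , P , colors⊆P , ∣P∣≤n ← bound (suc n) (s≤s z≤n) (coloring (2 * suc m) n)
    = ℕ.1+n≰n (begin
      suc n             ≡⟨ ∣⊤∣≡n (suc n) ⟨
      ∣ ⊤ {suc n} ∣     ≤⟨ p⊆q⇒∣p∣≤∣q∣ {p = ⊤} {P} (λ {c} _ → colors⊆P (allColors m n w c)) ⟩
      ∣ P ∣             ≤⟨ ∣P∣≤n ⟩
      n                 ∎)
    where open ℕ.≤-Reasoning

theorem4p3 : (H : Grp) → IsHallUniversalGroup H →
    (∀ (m : ℕ) → 0 < m → T[ D (2 * m) , H ]≡∞) × (¬ HasFiniteBigRamseyDegrees H)
theorem4p3 H hall = infinite , λ finite → infinite 1 (s≤s z≤n)
    (finite (record { group = D 2 ; inclusion = embedDihedral 1 }) (D-fg 2))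
  where
  open HallGroup H hall
  infinite : ∀ m → 0 < m → T[ D (2 * m) , H ]≡∞
  infinite (suc m) _ (n , _ , bound , _) = noBound m n bound
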